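{- Let $\mathcal{M},\mathcal{N}$ be structures with $M\subseteq N^n$ and suppose that the inclusion $M\hookrightarrow N^n$ is a trace definition of $\mathcal{M}$ in $\mathcal{N}$. Suppose that $X$ is an $\mathcal{M}$-definable subset of $M^m$ and $Y$ is an $\mathcal{N}$-definable subset of $N^{mn}$ such that $X=Y\cap M^m$. Then $\mathrm{RM}_{\mathcal{M}}(X)\le\mathrm{RM}_{\mathcal{N}}(Y)$.
   Context: "Definable" means first order definable with parameters. A map $\tau\colon M\to N^n$ is a trace definition of $\mathcal{M}$ in $\mathcal{N}$ if for every $m\ge 1$ and every $\mathcal{M}$-definable $X\subseteq M^m$ there is an $\mathcal{N}$-definable $Y\subseteq N^{mn}$ with $X=\{(a_1,\dots,a_m)\in M^m : (\tau(a_1),\dots,\tau(a_m))\in Y\}$. $\mathrm{RM}_{\mathcal{M}}(X)$ is the Morley rank of the definable set $X$ in $\mathcal{M}$ (computed, as usual, in a sufficiently saturated elementary extension; $\infty$ if not an ordinal). -}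

module Defs where

open import Level using (Level; _⊔_; Lift) renaming (suc to lsuc)
open import Data.Nat.Base using (ℕ; _+_; _*_; _≤_)
open import Data.Fin.Base using (Fin)
open import Data.Vec.Base using (Vec; []; _∷_; _++_; lookup; map; concat)
open import Data.List.Base using (List)
open import Data.List.Relation.Unary.All using (All)
open import Data.Product.Base using (Σ; _×_)
open import Data.Sum.Base using (_⊎_)
open import Data.Empty.Polymorphic using (⊥)
open import Function.Bundles using (_⇔_)
open import Relation.Binary.PropositionalEquality.Core using (_≡_; _≢_)
open import Relation.Unary using (Pred; _∈_; _⊆_; _≐_; Satisfiable)
  renaming (_⊥_ to _disjoint-from_)

------------------------------------------------------------------------
-- First-order logic

record Language (ℓ : Level) : Set (lsuc ℓ) where
  field
    Func : ℕ → Set ℓ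
    Rel  : ℕ → Set ℓ

open Language public

-- Terms and formulas whose free variables are among n de Bruijn
-- indices; a quantifier binds index zero.
data Term {ℓ : Level} (L : Language ℓ) (n : ℕ) : Set ℓ where
  var : Fin n → Term L n
  app : ∀ {k} → Func L k → Vec (Term L n) k → Term L n

infix  8 _≈̇_
infixr 7 _∧̇_
infixr 6 _∨̇_
infixr 5 _⇒̇_

data Formula {ℓ : Level} (L : Language ℓ) : ℕ → Set ℓ where
  _≈̇_            : ∀ {n} → Term L n → Term L n → Formula L n
  rel            : ∀ {n k} → Rel L k → Vec (Term L n) k → Formula L n
  ⊥̇              : ∀ {n} → Formula L n
  _∧̇_ _∨̇_ _⇒̇_ : ∀ {n} → Formula L n → Formula L n → Formula L n
  ∀̇_ ∃̇_         : ∀ {n} → Formula L (1 + n) → Formula L n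

record Structure {ℓ : Level} (L : Language ℓ) : Set (lsuc ℓ) where
  field
    Carrier : Set ℓ
    funcᴵ   : ∀ {k} → Func L k → Vec Carrier k → Carrier
    relᴵ    : ∀ {k} → Rel L k → Vec Carrier k → Set ℓ

open Structure public

module _ {ℓ : Level} {L : Language ℓ} (M : Structure L) where

  mutual
    eval : ∀ {n} → Vec (Carrier M) n → Term L n → Carrier M
    eval ρ (var i)    = lookup ρ i
    eval ρ (app f ts) = funcᴵ M f (evals ρ ts)

    evals : ∀ {n k} → Vec (Carrier M) n → Vec (Term L n) k → Vec (Carrier M) k
    evals ρ []       = []
    evals ρ (t ∷ ts) = eval ρ t ∷ evals ρ ts

infix 4 _⊨_[_]

_⊨_[_] : ∀ {ℓ : Level} {L : Language ℓ} {n : ℕ} (M : Structure L) →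
         Formula L n → Vec (Carrier M) n → Set ℓ
M ⊨ s ≈̇ t    [ ρ ] = eval M ρ s ≡ eval M ρ t
M ⊨ rel R ts [ ρ ] = relᴵ M R (evals M ρ ts)
M ⊨ ⊥̇        [ ρ ] = ⊥
M ⊨ φ ∧̇ ψ    [ ρ ] = M ⊨ φ [ ρ ] × M ⊨ ψ [ ρ ]
M ⊨ φ ∨̇ ψ    [ ρ ] = M ⊨ φ [ ρ ] ⊎ M ⊨ ψ [ ρ ]
M ⊨ φ ⇒̇ ψ    [ ρ ] = M ⊨ φ [ ρ ] → M ⊨ ψ [ ρ ]
M ⊨ ∀̇ φ      [ ρ ] = (a : Carrier M) → M ⊨ φ [ a ∷ ρ ]
M ⊨ ∃̇ φ      [ ρ ] = Σ (Carrier M) λ a → M ⊨ φ [ a ∷ ρ ]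

-- A definable subset of M ^ m is kept together with a defining formula
-- φ (x , c), so that the same φ (x , c) can be read in an elementary
-- extension.
record DefinableSet {ℓ : Level} {L : Language ℓ} (M : Structure L) (m : ℕ) : Set ℓ where
  constructor definable
  field
    {#params} : ℕ
    formula   : Formula L (m + #params)
    params    : Vec (Carrier M) #params

open DefinableSet public

⟦_⟧ : ∀ {ℓ : Level} {L : Language ℓ} {M : Structure L} {m : ℕ} →
      DefinableSet M m → Pred (Vec (Carrier M) m) ℓ
⟦_⟧ {M = M} D x = M ⊨ formula D [ x ++ params D ]

------------------------------------------------------------------------
-- Saturated elementary extensions

record ElementaryExtension {ℓ : Level} {L : Language ℓ} (M : Structure L) : Set (lsuc ℓ) where
  field
    extension  : Structure L
    embed      : Carrier M → Carrier extension
    elementary : ∀ {n} (φ : Formula L n) (a : Vec (Carrier M) n) →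
                 M ⊨ φ [ a ] ⇔ extension ⊨ φ [ map embed a ]

open ElementaryExtension public

-- Every set p (x , c) of formulas in finitely many variables x, over a
-- finite tuple c of parameters, is realised once it is finitely
-- satisfiable.
ℵ₀-Saturated : ∀ {ℓ : Level} {L : Language ℓ} → Structure L → Set (lsuc ℓ)
ℵ₀-Saturated {ℓ} {L} M =
  ∀ {j k : ℕ} (c : Vec (Carrier M) k) (p : Pred (Formula L (j + k)) ℓ) →
  ((Δ : List (Formula L (j + k))) → All p Δ →
     Σ (Vec (Carrier M) j) λ x → All (λ φ → M ⊨ φ [ x ++ c ]) Δ) →
  Σ (Vec (Carrier M) j) λ x → ∀ φ → φ ∈ p → M ⊨ φ [ x ++ c ]

record SaturatedExtension {ℓ : Level} {L : Language ℓ} (M : Structure L) : Set (lsuc ℓ) where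
  field
    elementaryExtension : ElementaryExtension M
    saturated           : ℵ₀-Saturated (extension elementaryExtension)

open SaturatedExtension public

extend : ∀ {ℓ : Level} {L : Language ℓ} {M : Structure L} {m : ℕ}
         (M* : ElementaryExtension M) →
         DefinableSet M m → DefinableSet (extension M*) m
extend M* D = definable (formula D) (map (embed M*) (params D))

------------------------------------------------------------------------
-- Morley rank

-- Ordinal notations: lim _ f is the supremum of the family f, whose
-- index set is required to be inhabited (classically every ordinal of
-- the universe at level o has such a notation).
data Ord (o : Level) : Set (lsuc o) where
  zero : Ord o
  suc  : Ord o → Ord o
  lim  : {I : Set o} → I → (I → Ord o) → Ord o

RM≥ : ∀ {o ℓ : Level} {L : Language ℓ} (M : Structure L) {m : ℕ} →
      Ord o → DefinableSet M m → Set (o ⊔ ℓ)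
RM≥ {o} M zero D = Lift o (Satisfiable ⟦ D ⟧)
RM≥ M {m} (suc α) D =
  Σ (ℕ → DefinableSet M m) λ E →
    (∀ i → ⟦ E i ⟧ ⊆ ⟦ D ⟧) ×
    (∀ i j → i ≢ j → ⟦ E i ⟧ disjoint-from ⟦ E j ⟧) ×
    (∀ i → RM≥ M α (E i))
RM≥ M (lim {I} _ f) D = (i : I) → RM≥ M (f i) D

-- A rank is -∞, an ordinal or ∞, and is represented by the class of
-- ordinals below or equal to it (none, {α ∣ α ≤ rank}, or all of them).
-- Thus comparing ranks is comparing these classes by inclusion, and no
-- decision is needed as to whether a rank is an ordinal.
Rank : (o a : Level) → Set (lsuc (o ⊔ a))
Rank o a = Pred (Ord o) a

infix 4 _≤ᴿ_

_≤ᴿ_ : ∀ {o a b : Level} → Rank o a → Rank o b → Set (lsuc o ⊔ a ⊔ b)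
r ≤ᴿ s = r ⊆ s

RM : ∀ (o : Level) {ℓ : Level} {L : Language ℓ} {M : Structure L} {m : ℕ} →
     SaturatedExtension M → DefinableSet M m → Rank o (o ⊔ ℓ)
RM o M* D α =
  RM≥ (extension (elementaryExtension M*)) α (extend (elementaryExtension M*) D)

------------------------------------------------------------------------
-- Trace definitions

-- The points of M ^ m whose image under τ × ⋯ × τ lies in Y ⊆ N ^ (m n).
Trace : ∀ {ℓ : Level} {L K : Language ℓ} {M : Structure L} {N : Structure K} {n m : ℕ} →
        (Carrier M → Vec (Carrier N) n) → DefinableSet N (m * n) →
        Pred (Vec (Carrier M) m) ℓ
Trace τ Y a = concat (map τ a) ∈ ⟦ Y ⟧

IsTraceDefinition : ∀ {ℓ : Level} {L K : Language ℓ}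
                    (M : Structure L) (N : Structure K) {n : ℕ} →
                    (Carrier M → Vec (Carrier N) n) → Set ℓ
IsTraceDefinition M N {n} τ =
  ∀ (m : ℕ) → 1 ≤ m → (X : DefinableSet M m) →
  Σ (DefinableSet N (m * n)) λ Y → ⟦ X ⟧ ≐ Trace {M = M} {N = N} τ Y

{-# OPTIONS --safe #-}

-- No ultraproduct or choice of complete types is needed.  Along the proof a
-- finite tuple c of M* is tied to a finite tuple d of N* by asking that d
-- satisfies every formula forced on it by the type of c through the inclusion
-- of M in N ^ n.  Saturation of N* extends d whenever c is extended.  By
-- induction on α, RM ≥ α passes from a set V (x , c) to a set U (y , d) as soon
-- as the trace of U contains V: pairwise disjoint subsets Eᵢ of V are traces
-- of sets Ψᵢ, and the U ∧ Ψᵢ ∧ ⋀_{j < i} ¬ Ψⱼ are pairwise disjoint with ranks at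
-- least those of the Eᵢ.

module Submission where

open import Defs
open import Level using (Level; lift; lower; _⊔_) renaming (suc to lsuc)
open import Data.Fin.Base using (Fin; zero; suc; _↑ˡ_; _↑ʳ_)
open import Data.List.Base using (List; []; _∷_)
open import Data.List.Relation.Unary.All using (All; []; _∷_)
open import Data.Nat.Base using (ℕ; zero; suc; _+_; _*_; _≤_; _<_; z≤n; _≤′_; ≤′-refl; ≤′-step)
open import Data.Nat.Properties
  using (<-cmp; ≤⇒≤′; ≤-trans; m≤m+n; suc-injective; *-distribʳ-+; +-assoc)
open import Data.Product.Base using (Σ; _×_; _,_; proj₁; proj₂)
open import Data.Product.Function.NonDependent.Propositional using (_×-⇔_)
open import Data.Sum.Function.Propositional using (_⊎-⇔_)
open import Data.Unit.Polymorphic.Base using (⊤; tt)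
open import Data.Vec.Base using (Vec; []; _∷_; _++_; allFin; cast; concat; lookup; map)
open import Data.Vec.Properties
  using (lookup-map; lookup-++ˡ; lookup-++ʳ; map-∘; map-cong; map-++; map-cast; cast-is-id;
         cast-trans; cast-++ʳ; ++-assoc-eqFree; map-lookup-allFin)
open import Function.Base using (_∘_; id)
open import Function.Bundles using (_⇔_; mk⇔; Equivalence)
open import Function.Construct.Identity using (⇔-id)
open import Function.Definitions using (Injective)
open import Function.Related.TypeIsomorphisms using (→-cong-⇔)
open import Relation.Binary.Definitions using (tri<; tri≈; tri>)
open import Relation.Binary.PropositionalEquality
  using (_≡_; _≢_; refl; sym; trans; cong; cong₂; subst; module ≡-Reasoning)
open import Relation.Nullary.Negation using (¬_; contradiction)
open import Relation.Unary using (Pred; _⊆_; _≐_) renaming (_⊥_ to _disjoint-from_)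

open Equivalence using (to; from)

private
  variable
    o ℓ : Level
    L K : Language ℓ
    A B : Set ℓ
    h j k l m n q : ℕ

-- Renaming of variables

mutual
  renameTerm : Vec (Fin k) n → Term L n → Term L k
  renameTerm r (var i)    = var (lookup r i)
  renameTerm r (app f ts) = app f (renameTerms r ts)

  renameTerms : Vec (Fin k) n → Vec (Term L n) j → Vec (Term L k) j
  renameTerms r []       = []
  renameTerms r (t ∷ ts) = renameTerm r t ∷ renameTerms r ts

rename : Vec (Fin k) n → Formula L n → Formula L k
rename r (s ≈̇ t)    = renameTerm r s ≈̇ renameTerm r t
rename r (rel R ts) = rel R (renameTerms r ts)
rename r ⊥̇          = ⊥̇
rename r (φ ∧̇ ψ)    = rename r φ ∧̇ rename r ψ
rename r (φ ∨̇ ψ)    = rename r φ ∨̇ rename r ψ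
rename r (φ ⇒̇ ψ)    = rename r φ ⇒̇ rename r ψ
rename r (∀̇ φ)      = ∀̇ rename (zero ∷ map suc r) φ
rename r (∃̇ φ)      = ∃̇ rename (zero ∷ map suc r) φ

module _ (S : Structure L) where

  mutual
    eval-renameTerm : (r : Vec (Fin k) n) (v : Vec (Carrier S) k) (t : Term L n) →
                      eval S v (renameTerm r t) ≡ eval S (map (lookup v) r) t
    eval-renameTerm r v (var i)    = sym (lookup-map i (lookup v) r)
    eval-renameTerm r v (app f ts) = cong (funcᴵ S f) (evals-renameTerms r v ts)

    evals-renameTerms : (r : Vec (Fin k) n) (v : Vec (Carrier S) k) (ts : Vec (Term L n) j) →
                        evals S v (renameTerms r ts) ≡ evals S (map (lookup v) r) ts
    evals-renameTerms r v []       = refl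
    evals-renameTerms r v (t ∷ ts) = cong₂ _∷_ (eval-renameTerm r v t) (evals-renameTerms r v ts)

  ⊨-rename : (r : Vec (Fin k) n) (v : Vec (Carrier S) k) (φ : Formula L n) →
             S ⊨ rename r φ [ v ] ⇔ S ⊨ φ [ map (lookup v) r ]
  -- Looking up `map suc r` in `a ∷ v` is looking up `r` in `v`, so the witness `a` of a quantifier
  -- stays untouched.
  ⊨-rename-binder : (r : Vec (Fin k) n) (v : Vec (Carrier S) k) (φ : Formula L (1 + n)) →
                    ∀ a → S ⊨ rename (zero ∷ map suc r) φ [ a ∷ v ] ⇔ S ⊨ φ [ a ∷ map (lookup v) r ]

  ⊨-rename r v (s ≈̇ t) rewrite eval-renameTerm r v s | eval-renameTerm r v t = ⇔-id _
  ⊨-rename r v (rel R ts) rewrite evals-renameTerms r v ts = ⇔-id _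
  ⊨-rename r v ⊥̇ = ⇔-id _
  ⊨-rename r v (φ ∧̇ ψ) = ⊨-rename r v φ ×-⇔ ⊨-rename r v ψ
  ⊨-rename r v (φ ∨̇ ψ) = ⊨-rename r v φ ⊎-⇔ ⊨-rename r v ψ
  ⊨-rename r v (φ ⇒̇ ψ) = →-cong-⇔ (⊨-rename r v φ) (⊨-rename r v ψ)
  ⊨-rename r v (∀̇ φ) =
    mk⇔ (λ p a → to (⊨-rename-binder r v φ a) (p a)) (λ p a → from (⊨-rename-binder r v φ a) (p a))
  ⊨-rename r v (∃̇ φ) =
    mk⇔ (λ (a , p) → a , to (⊨-rename-binder r v φ a) p)
        (λ (a , p) → a , from (⊨-rename-binder r v φ a) p)

  ⊨-rename-binder r v φ a =
    subst (λ w → S ⊨ rename (zero ∷ map suc r) φ [ a ∷ v ] ⇔ S ⊨ φ [ a ∷ w ])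
          (sym (map-∘ (lookup (a ∷ v)) suc r))
          (⊨-rename (zero ∷ map suc r) (a ∷ v) φ)

  ⊨-rename-≡ : (r : Vec (Fin k) n) {v : Vec (Carrier S) k} {w : Vec (Carrier S) n} →
               map (lookup v) r ≡ w → (φ : Formula L n) → S ⊨ rename r φ [ v ] ⇔ S ⊨ φ [ w ]
  ⊨-rename-≡ r refl φ = ⊨-rename r _ φ

-- Variables split into three blocks

map-lookup-++ˡ : (xs : Vec A m) (ys : Vec A n) (r : Vec (Fin m) k) →
                 map (lookup (xs ++ ys)) (map (_↑ˡ n) r) ≡ map (lookup xs) r
map-lookup-++ˡ xs ys r = trans (sym (map-∘ _ _ r)) (map-cong (lookup-++ˡ xs ys) r)

map-lookup-++ʳ : (xs : Vec A m) (ys : Vec A n) (r : Vec (Fin n) k) →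
                 map (lookup (xs ++ ys)) (map (m ↑ʳ_) r) ≡ map (lookup ys) r
map-lookup-++ʳ xs ys r = trans (sym (map-∘ _ _ r)) (map-cong (lookup-++ʳ xs ys) r)

block₁ : ∀ m j k → Vec (Fin m) h → Vec (Fin (m + (j + k))) h
block₁ m j k = map (_↑ˡ (j + k))

block₂ : ∀ m j k → Vec (Fin j) h → Vec (Fin (m + (j + k))) h
block₂ m j k = map (m ↑ʳ_) ∘ map (_↑ˡ k)

block₃ : ∀ m j k → Vec (Fin k) h → Vec (Fin (m + (j + k))) h
block₃ m j k = map (m ↑ʳ_) ∘ map (j ↑ʳ_)

module _ (xs : Vec A m) (ys : Vec A j) (zs : Vec A k) where

  lookup-block₁ : (r : Vec (Fin m) h) →
                  map (lookup (xs ++ (ys ++ zs))) (block₁ m j k r) ≡ map (lookup xs) r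
  lookup-block₁ = map-lookup-++ˡ xs (ys ++ zs)

  lookup-block₂ : (r : Vec (Fin j) h) →
                  map (lookup (xs ++ (ys ++ zs))) (block₂ m j k r) ≡ map (lookup ys) r
  lookup-block₂ r = trans (map-lookup-++ʳ xs (ys ++ zs) _) (map-lookup-++ˡ ys zs r)

  lookup-block₃ : (r : Vec (Fin k) h) →
                  map (lookup (xs ++ (ys ++ zs))) (block₃ m j k r) ≡ map (lookup zs) r
  lookup-block₃ r = trans (map-lookup-++ʳ xs (ys ++ zs) _) (map-lookup-++ʳ ys zs r)

-- A link grows by new parameters placed between the point and the old parameters: `skip₂` carries
-- old formulas over, `skip₃` imports formulas about the new parameters alone.
skip₂ : ∀ m j k → Formula L (m + k) → Formula L (m + (j + k))
skip₂ m j k = rename (block₁ m j k (allFin m) ++ block₃ m j k (allFin k))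

skip₃ : ∀ m j k → Formula L (m + j) → Formula L (m + (j + k))
skip₃ m j k = rename (block₁ m j k (allFin m) ++ block₂ m j k (allFin j))

skipʳ : ∀ m k → Formula L m → Formula L (m + k)
skipʳ m k = rename (map (_↑ˡ k) (allFin m))

module _ (S : Structure L) where

  ⊨-skip₂ : (xs : Vec (Carrier S) m) (ys : Vec (Carrier S) j) (zs : Vec (Carrier S) k)
            (φ : Formula L (m + k)) →
            S ⊨ skip₂ m j k φ [ xs ++ (ys ++ zs) ] ⇔ S ⊨ φ [ xs ++ zs ]
  ⊨-skip₂ {m = m} {j = j} {k = k} xs ys zs =
    ⊨-rename-≡ S _ (trans (map-++ _ (block₁ m j k (allFin m)) _) (cong₂ _++_
    (trans (lookup-block₁ xs ys zs _) (map-lookup-allFin xs))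
    (trans (lookup-block₃ xs ys zs _) (map-lookup-allFin zs))))

  ⊨-skip₃ : (xs : Vec (Carrier S) m) (ys : Vec (Carrier S) j) (zs : Vec (Carrier S) k)
            (φ : Formula L (m + j)) →
            S ⊨ skip₃ m j k φ [ xs ++ (ys ++ zs) ] ⇔ S ⊨ φ [ xs ++ ys ]
  ⊨-skip₃ {m = m} {j = j} {k = k} xs ys zs =
    ⊨-rename-≡ S _ (trans (map-++ _ (block₁ m j k (allFin m)) _) (cong₂ _++_
    (trans (lookup-block₁ xs ys zs _) (map-lookup-allFin xs))
    (trans (lookup-block₂ xs ys zs _) (map-lookup-allFin ys))))

  ⊨-skipʳ : (xs : Vec (Carrier S) m) (ys : Vec (Carrier S) k) (φ : Formula L m) →
            S ⊨ skipʳ m k φ [ xs ++ ys ] ⇔ S ⊨ φ [ xs ]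
  ⊨-skipʳ xs ys = ⊨-rename-≡ S _ (trans (map-lookup-++ˡ xs ys _) (map-lookup-allFin xs))

-- Concatenation of tuples of n-tuples

join : ∀ m j → Vec A (m * n) → Vec A (j * n) → Vec A ((m + j) * n)
join {n = n} m j xs ys = cast (sym (*-distribʳ-+ n m j)) (xs ++ ys)

map-join : ∀ (f : A → B) m j (xs : Vec A (m * n)) (ys : Vec A (j * n)) →
           map f (join m j xs ys) ≡ join m j (map f xs) (map f ys)
map-join f m j xs ys = trans (map-cast f _ (xs ++ ys)) (cong (cast _) (map-++ f xs ys))

concat-++ : (xss : Vec (Vec A n) m) (yss : Vec (Vec A n) j) →
            join m j (concat xss) (concat yss) ≡ concat (xss ++ yss)
concat-++ [] yss = cast-is-id refl (concat yss)
concat-++ {n = n} {m = suc m} {j = j} (xs ∷ xss) yss = begin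
  cast _ ((xs ++ concat xss) ++ concat yss)
    ≡⟨ cast-trans (+-assoc n (m * n) (j * n)) eq ((xs ++ concat xss) ++ concat yss) ⟨
  cast eq (cast _ ((xs ++ concat xss) ++ concat yss))
    ≡⟨ cong (cast eq) (++-assoc-eqFree xs (concat xss) (concat yss)) ⟩
  cast eq (xs ++ (concat xss ++ concat yss))
    ≡⟨ cast-++ʳ (sym (*-distribʳ-+ n m j)) xs ⟩
  xs ++ join m j (concat xss) (concat yss)
    ≡⟨ cong (xs ++_) (concat-++ xss yss) ⟩
  xs ++ concat (xss ++ yss) ∎
  where
  open ≡-Reasoning
  eq : n + (m * n + j * n) ≡ n + (m + j) * n
  eq = cong (n +_) (sym (*-distribʳ-+ n m j))

spread-join : ∀ m j n q l → Vec (Fin (m * n + ((j * n + q) + l))) ((m + j) * n)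
spread-join m j n q l =
  join m j (block₁ (m * n) (j * n + q) l (allFin (m * n)))
           (block₂ (m * n) (j * n + q) l (map (_↑ˡ q) (allFin (j * n))))

-- A trace formula reads point and parameters as one tuple, followed by its constants. A link stores
-- parameters and constants together, in front of the older parameters.
spread : ∀ m j n q l → Formula L ((m + j) * n + q) → Formula L (m * n + ((j * n + q) + l))
spread m j n q l =
  rename (spread-join m j n q l ++ block₂ (m * n) (j * n + q) l (map (j * n ↑ʳ_) (allFin q)))

module _ {m j : ℕ} (xs : Vec A (m * n)) (ys : Vec A (j * n)) (es : Vec A q) (zs : Vec A l) where

  lookup-spread-join : map (lookup (xs ++ ((ys ++ es) ++ zs))) (spread-join m j n q l) ≡ join m j xs ys
  lookup-spread-join =
    trans (map-join _ m j (block₁ (m * n) (j * n + q) l (allFin (m * n))) _) (cong₂ (join m j)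
      (trans (lookup-block₁ xs (ys ++ es) zs _) (map-lookup-allFin xs))
      (trans (lookup-block₂ xs (ys ++ es) zs _)
        (trans (map-lookup-++ˡ ys es _) (map-lookup-allFin ys))))

⊨-spread : (S : Structure L) (xs : Vec (Carrier S) (m * n)) (ys : Vec (Carrier S) (j * n))
           (es : Vec (Carrier S) q) (zs : Vec (Carrier S) l) (φ : Formula L ((m + j) * n + q)) →
           S ⊨ spread m j n q l φ [ xs ++ ((ys ++ es) ++ zs) ] ⇔ S ⊨ φ [ join m j xs ys ++ es ]
⊨-spread {m = m} {n = n} {j = j} {q = q} {l = l} S xs ys es zs =
  ⊨-rename-≡ S _ (trans (map-++ _ (spread-join m j n q l) _) (cong₂ _++_
    (lookup-spread-join {m = m} {j = j} xs ys es zs)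
    (trans (lookup-block₂ xs (ys ++ es) zs _)
      (trans (map-lookup-++ʳ ys es _) (map-lookup-allFin es)))))

-- Negation, blocks of quantifiers, monotonicity of rank

infix 9 ¬̇_

¬̇_ : Formula L n → Formula L n
¬̇ φ = φ ⇒̇ ⊥̇

∃* : ∀ j → Formula L (j + k) → Formula L k
∃* zero    φ = φ
∃* (suc j) φ = ∃* j (∃̇ φ)

⊨-∃* : (S : Structure L) (c : Vec (Carrier S) k) (φ : Formula L (j + k)) →
       S ⊨ ∃* j φ [ c ] ⇔ Σ (Vec (Carrier S) j) λ x → S ⊨ φ [ x ++ c ]
⊨-∃* {j = zero}  S c φ = mk⇔ (λ p → [] , p) λ { ([] , p) → p }
⊨-∃* {j = suc j} S c φ = mk⇔
  (λ p → let x , a , s = to (⊨-∃* S c (∃̇ φ)) p in a ∷ x , s)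
  λ { (a ∷ x , s) → from (⊨-∃* S c (∃̇ φ)) (x , a , s) }

RM≥-mono : (S : Structure L) (α : Ord o) {D D′ : DefinableSet S m} →
           ⟦ D ⟧ ⊆ ⟦ D′ ⟧ → RM≥ S α D → RM≥ S α D′
RM≥-mono S zero      D⊆D′ (lift (x , x∈D))      = lift (x , D⊆D′ x∈D)
RM≥-mono S (suc α)   D⊆D′ (E , E⊆D , disj , rk) = E , (λ i → D⊆D′ ∘ E⊆D i) , disj , rk
RM≥-mono S (lim _ f) D⊆D′ rk i                  = RM≥-mono S (f i) D⊆D′ (rk i)

-- Transfer along linked tuples

module _ {L K : Language ℓ} (M M* : Structure L) (N N* : Structure K)
         (saturated* : ℵ₀-Saturated N*) where

  Forces : {I : Set ℓ} → (I → Vec (Carrier M) k) → (I → Vec (Carrier N) l) →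
           Formula L k → Formula K l → Set ℓ
  Forces s t χ θ = ∀ i → M ⊨ χ [ s i ] → N ⊨ θ [ t i ]

  -- Classically, the pair of types of `c` and `d` lies in the closure of the pairs of types of
  -- `s i` and `t i`.
  Linked : {I : Set ℓ} → (I → Vec (Carrier M) k) → (I → Vec (Carrier N) l) →
           Vec (Carrier M*) k → Vec (Carrier N*) l → Set ℓ
  Linked s t c d = ∀ χ θ → Forces s t χ θ → M* ⊨ χ [ c ] → N* ⊨ θ [ d ]

  -- The family (s , t) is the approximation in M and N of the pair (c , d);
  -- letting it range over an index set makes parameters from M and N
  -- (constant components) and variable components uniform.
  record Link (k l : ℕ) : Set (lsuc ℓ) where
    field
      {I}    : Set ℓ
      s      : I → Vec (Carrier M) k
      t      : I → Vec (Carrier N) l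
      c      : Vec (Carrier M*) k
      d      : Vec (Carrier N*) l
      linked : Linked s t c d

  -- Extending a link by saturation

  module _ (Λ : Link k l) (b : Vec (Carrier M*) j) (g : Vec (Carrier M) j → Vec (Carrier N) h) where
    open Link Λ

    s⁺ : I × Vec (Carrier M) j → Vec (Carrier M) (j + k)
    s⁺ (i , a) = a ++ s i

    t⁺ : I × Vec (Carrier M) j → Vec (Carrier N) (h + l)
    t⁺ (i , a) = g a ++ t i

    -- The partial type over `d` whose realisations are exactly the tuples that continue the link
    -- along `b`.
    ForcedFormula : Pred (Formula K (h + l)) ℓ
    ForcedFormula θ = Σ (Formula L (j + k)) λ χ → M* ⊨ χ [ b ++ c ] × Forces s⁺ t⁺ χ θ

    forced-conjunction : (Δ : List (Formula K (h + l))) → All ForcedFormula Δ →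
      Σ (Formula K (h + l)) λ θ → ForcedFormula θ ×
        (∀ v → N* ⊨ θ [ v ] → All (λ φ → N* ⊨ φ [ v ]) Δ)
    forced-conjunction []      []       =
      -- The true formula, as the empty conjunction.
      ⊥̇ ⇒̇ ⊥̇ , (⊥̇ ⇒̇ ⊥̇ , id , λ _ _ → id) , λ _ _ → []
    forced-conjunction (φ ∷ Δ) ((χ , hχ , χ⊢φ) ∷ ps) =
      let θ , (χ′ , hχ′ , χ′⊢θ) , sound = forced-conjunction Δ ps
      in φ ∧̇ θ , (χ ∧̇ χ′ , (hχ , hχ′) , λ i (p , p′) → χ⊢φ i p , χ′⊢θ i p′) ,
         λ v (p , p′) → p ∷ sound v p′

    -- If `χ` forces `θ`, then `∃* j χ` forces `∃* h θ` with witness `g a`, and the old link applies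
    -- to these formulas in `c` and `d`.
    forced-satisfiable : ∀ θ → ForcedFormula θ → Σ (Vec (Carrier N*) h) λ y → N* ⊨ θ [ y ++ d ]
    forced-satisfiable θ (χ , hχ , χ⊢θ) = to (⊨-∃* N* d θ) (linked (∃* j χ) (∃* h θ)
      (λ i p → let a , pa = to (⊨-∃* M (s i) χ) p in
               from (⊨-∃* N (t i) θ) (g a , χ⊢θ (i , a) pa))
      (from (⊨-∃* M* c χ) (b , hχ)))

    forced-realised : Σ (Vec (Carrier N*) h) λ y → ∀ θ → ForcedFormula θ → N* ⊨ θ [ y ++ d ]
    forced-realised = saturated* d ForcedFormula λ Δ ps →
      let θ , θ-forced , sound = forced-conjunction Δ ps
          y , hy               = forced-satisfiable θ θ-forced
      in y , sound (y ++ d) hy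

    extendLink : Link (j + k) (h + l)
    extendLink = record
      { s      = s⁺
      ; t      = t⁺
      ; c      = b ++ c
      ; d      = proj₁ forced-realised ++ d
      ; linked = λ χ θ χ⊢θ hχ → proj₂ forced-realised θ (χ , hχ , χ⊢θ)
      }

  -- Peeling off disjoint pieces along a trace definition

  module _ {n : ℕ} (ι : Carrier M → Vec (Carrier N) n) (ι-trace : IsTraceDefinition M N ι)
           {m : ℕ} (1≤m : 1 ≤ m) where

    τ : ∀ {j} → Vec (Carrier M) j → Vec (Carrier N) (j * n)
    τ a = concat (map ι a)

    τ-++ : (a : Vec (Carrier M) j) (b : Vec (Carrier M) k) → join j k (τ a) (τ b) ≡ τ (a ++ b)
    τ-++ a b = trans (concat-++ (map ι a) (map ι b)) (cong concat (sym (map-++ ι a b)))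

    -- Only points of `M` and `N` are compared, where `τ` is defined; the link carries the
    -- consequences to `M*` and `N*`.
    Covers : (Λ : Link k l) → Formula L (m + k) → Formula K (m * n + l) → Set ℓ
    Covers Λ V U = ∀ a i → M ⊨ V [ a ++ s i ] → N ⊨ U [ τ a ++ t i ]
      where open Link Λ

    -- The parameters of `φ` become further coordinates of the traced point, so one `ψ` with
    -- constants `e` serves all their values. This matters because the pieces have parameters in
    -- `M*`, outside the reach of `ι`.
    traceFormula : (φ : Formula L (m + j)) →
      Σ ℕ λ q → Σ (Vec (Carrier N) q) λ e → Σ (Formula K ((m + j) * n + q)) λ ψ →
        ∀ x → M ⊨ φ [ x ] ⇔ N ⊨ ψ [ τ x ++ e ]
    traceFormula {j = j} φ =
      -- `skipʳ` with 0 supplies the empty parameter block, since `(m + j) + 0` does not compute to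
      -- `m + j`.
      let Y , X⊆Y , Y⊆X = ι-trace (m + j) (≤-trans 1≤m (m≤m+n m j)) (definable (skipʳ (m + j) 0 φ) [])
      in _ , params Y , formula Y ,
         λ x → mk⇔ (X⊆Y ∘ from (⊨-skipʳ M x [] φ)) (to (⊨-skipʳ M x [] φ) ∘ Y⊆X)

    -- A stage in splitting off the sets Eᵢ one by one: V and U are what is left of
    -- the two sets, and E lists the pieces still to come.
    record Peeling (α : Ord o) : Set (lsuc ℓ ⊔ o) where
      field
        {p r}      : ℕ
        link       : Link p r
      open Link link public
      field
        V          : Formula L (m + p)
        U          : Formula K (m * n + r)
        covers     : Covers link V U
        E          : ℕ → DefinableSet M* m
        E⊆V        : ∀ i → ⟦ E i ⟧ ⊆ ⟦ definable {M = M*} V c ⟧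
        E-disjoint : ∀ i j → i ≢ j → ⟦ E i ⟧ disjoint-from ⟦ E j ⟧
        E-rank     : ∀ i → RM≥ M* α (E i)

    module Peel {α : Ord o} (P : Peeling α) where
      open Peeling P

      private
        b = params (E 0)
        φ = formula (E 0)
        w = proj₁ (traceFormula φ)
        e = proj₁ (proj₂ (traceFormula φ))
        ψ = proj₁ (proj₂ (proj₂ (traceFormula φ)))
        ψ-traces = proj₂ (proj₂ (proj₂ (traceFormula φ)))

        Φ : Formula L (m + (#params (E 0) + p))
        Φ = skip₃ m _ p φ

        Ψ : Formula K (m * n + ((#params (E 0) * n + w) + r))
        Ψ = spread m _ n w r ψ

        V↑ : Formula L (m + (#params (E 0) + p))
        V↑ = skip₂ m _ p V

        U↑ : Formula K (m * n + ((#params (E 0) * n + w) + r))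
        U↑ = skip₂ (m * n) _ r U

      -- The tuple found in `N*` stands in for the undefined value of `τ` at `b`, together with the
      -- constants `e`.
      link⁺ : Link (#params (E 0) + p) ((#params (E 0) * n + w) + r)
      link⁺ = extendLink link b (λ a → τ a ++ e)

      open Link link⁺ using () renaming (s to s′; t to t′; c to c′; d to d′)

      Φ⇔Ψ : ∀ a i → M ⊨ Φ [ a ++ s′ i ] ⇔ N ⊨ Ψ [ τ a ++ t′ i ]
      Φ⇔Ψ a (i , a′) = mk⇔
        (from N-side ∘ subst (λ v → N ⊨ ψ [ v ++ e ]) (sym (τ-++ a a′))
                     ∘ to (ψ-traces (a ++ a′)) ∘ to M-side)
        (from M-side ∘ from (ψ-traces (a ++ a′))
                     ∘ subst (λ v → N ⊨ ψ [ v ++ e ]) (τ-++ a a′) ∘ to N-side)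
        where
        M-side = ⊨-skip₃ M a a′ (s i) φ
        N-side = ⊨-spread {m = m} N (τ a) (τ a′) e (t i) ψ

      V↑⊢U↑ : Covers link⁺ V↑ U↑
      V↑⊢U↑ a (i , a′) = from (⊨-skip₂ N (τ a) (τ a′ ++ e) (t i) U) ∘ covers a i
                       ∘ to (⊨-skip₂ M a a′ (s i) V)

      Φ⇔E₀ : ∀ x → M* ⊨ Φ [ x ++ c′ ] ⇔ M* ⊨ φ [ x ++ b ]
      Φ⇔E₀ x = ⊨-skip₃ M* x b c φ

      V⊆V↑ : ∀ x → M* ⊨ V [ x ++ c ] → M* ⊨ V↑ [ x ++ c′ ]
      V⊆V↑ x = from (⊨-skip₂ M* x b c V)

      U↑⊆U : ∀ y → N* ⊨ U↑ [ y ++ d′ ] → N* ⊨ U [ y ++ d ]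
      U↑⊆U y = to (⊨-skip₂ N* y _ d U)

      headV : Formula L _
      headV = Φ ∧̇ V↑

      headU : Formula K _
      headU = Ψ ∧̇ U↑

      head : DefinableSet N* (m * n)
      head = definable headU d′

      head-covers : Covers link⁺ headV headU
      head-covers a i (p , v) = to (Φ⇔Ψ a i) p , V↑⊢U↑ a i v

      head-rank : RM≥ M* α (definable headV c′)
      head-rank = RM≥-mono M* α (λ {x} p → from (Φ⇔E₀ x) p , V⊆V↑ x (E⊆V 0 p)) (E-rank 0)

      tail : Peeling α
      tail = record
        { link       = link⁺
        ; V          = V↑ ∧̇ ¬̇ Φ
        ; U          = U↑ ∧̇ ¬̇ Ψ
        -- Removing `Ψ` loses no point of the remaining set, because the trace of `Ψ` is contained
        -- in `Φ`.
        ; covers     = λ a i (v , ¬p) → V↑⊢U↑ a i v , ¬p ∘ from (Φ⇔Ψ a i)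
        ; E          = E ∘ suc
        ; E⊆V        = λ i {x} p → V⊆V↑ x (E⊆V (suc i) p) ,
                         λ p₀ → contradiction (to (Φ⇔E₀ x) p₀ , p) (E-disjoint 0 (suc i) (λ ()))
        ; E-disjoint = λ i j i≢j → E-disjoint (suc i) (suc j) (i≢j ∘ suc-injective)
        ; E-rank     = E-rank ∘ suc
        }

    remaining : {α : Ord o} → Peeling α → DefinableSet N* (m * n)
    remaining P = definable U d
      where open Peeling P

    module _ {α : Ord o} (P : Peeling α) where

      peel : ℕ → Peeling α
      peel zero    = P
      peel (suc i) = Peel.tail (peel i)

      heads : ℕ → DefinableSet N* (m * n)
      heads i = Peel.head (peel i)

      remaining-antitone : ∀ {i j} → i ≤′ j → ∀ y →
                           ⟦ remaining (peel j) ⟧ y → ⟦ remaining (peel i) ⟧ y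
      remaining-antitone ≤′-refl               y y∈ = y∈
      remaining-antitone (≤′-step {n = j} i≤j) y y∈ =
        remaining-antitone i≤j y (Peel.U↑⊆U (peel j) y (proj₁ y∈))

      head⊆remaining : ∀ i y → ⟦ heads i ⟧ y → ⟦ remaining (peel i) ⟧ y
      head⊆remaining i y y∈ = Peel.U↑⊆U (peel i) y (proj₂ y∈)

      heads⊆ : ∀ i → ⟦ heads i ⟧ ⊆ ⟦ remaining P ⟧
      heads⊆ i {y} y∈ = remaining-antitone {j = i} (≤⇒≤′ z≤n) y (head⊆remaining i y y∈)

      -- Head j lies in what remains after stage i, which excludes the `Ψ` of that stage, whereas
      -- head i lies inside that `Ψ`.
      heads-disjoint-< : ∀ {i j} → i < j → ∀ y → ⟦ heads i ⟧ y → ¬ ⟦ heads j ⟧ y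
      heads-disjoint-< {i} {j} i<j y y∈i y∈j =
        lower (proj₂ (remaining-antitone {j = j} (≤⇒≤′ i<j) y (head⊆remaining j y y∈j)) (proj₁ y∈i))

      heads-disjoint : ∀ i j → i ≢ j → ⟦ heads i ⟧ disjoint-from ⟦ heads j ⟧
      heads-disjoint i j i≢j {y} (y∈i , y∈j) with <-cmp i j
      ... | tri< i<j _ _ = heads-disjoint-< i<j y y∈i y∈j
      ... | tri≈ _ i≡j _ = i≢j i≡j
      ... | tri> _ _ j<i = heads-disjoint-< j<i y y∈j y∈i

    -- The link varies in the induction on `α`: each piece brings its own parameters, so the
    -- hypothesis is applied over longer tuples.
    RM≥-transfer : (α : Ord o) (Λ : Link k l) (V : Formula L (m + k)) (U : Formula K (m * n + l)) →
                   Covers Λ V U →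
                   RM≥ M* α (definable V (Link.c Λ)) → RM≥ N* α (definable U (Link.d Λ))
    RM≥-transfer zero Λ V U V⊢U (lift (a , p)) =
      -- The point `a` itself is treated as new parameters and linked along `τ`; its partner in `N*`
      -- satisfies `U` since `V` forces `U`.
      lift (_ , Link.linked (extendLink Λ a τ) V U (λ (i , a′) → V⊢U a′ i) p)
    RM≥-transfer (suc α) Λ V U V⊢U (E , E⊆V , E-disjoint , E-rank) =
      heads P , heads⊆ P , heads-disjoint P , λ i → let open Peel (peel P i) in
        RM≥-transfer α link⁺ headV headU head-covers head-rank
      where
      P : Peeling α
      P = record
        { link = Λ ; V = V ; U = U ; covers = V⊢U
        ; E = E ; E⊆V = E⊆V ; E-disjoint = E-disjoint ; E-rank = E-rank }
    RM≥-transfer (lim _ f) Λ V U V⊢U rank i = RM≥-transfer (f i) Λ V U V⊢U (rank i)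

-- Comparison of Morley ranks

proposition3p10 : ∀ {o ℓ : Level} {L K : Language ℓ} (M : Structure L) (N : Structure K) {n : ℕ}
    (ι : Carrier M → Vec (Carrier N) n) →
    Injective _≡_ _≡_ ι →
    IsTraceDefinition M N ι →
    ∀ {m : ℕ} → 1 ≤ m →
    (X : DefinableSet M m) (Y : DefinableSet N (m * n)) →
    ⟦ X ⟧ ≐ Trace {M = M} {N = N} ι Y →
    (M* : SaturatedExtension M) (N* : SaturatedExtension N) →
    RM o M* X ≤ᴿ RM o N* Y
proposition3p10 M N ι _ ι-trace 1≤m X Y (X⊆Y , _) M* N* {α} =
  RM≥-transfer M (extension Mᵉ) N (extension Nᵉ) (saturated N*) ι ι-trace 1≤m
    α link (formula X) (formula Y) (λ a _ → X⊆Y)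
  where
  Mᵉ = elementaryExtension M*
  Nᵉ = elementaryExtension N*

  -- The parameters lie in `M` and `N`, so a one-point family approximates them: `χ` descends to
  -- `M`, forces `θ` in `N`, and `θ` ascends to `N*`.
  link : Link M (extension Mᵉ) N (extension Nᵉ) (saturated N*) (#params X) (#params Y)
  link = record
    { I      = ⊤
    ; s      = λ _ → params X
    ; t      = λ _ → params Y
    ; c      = map (embed Mᵉ) (params X)
    ; d      = map (embed Nᵉ) (params Y)
    ; linked = λ χ θ χ⊢θ → to (elementary Nᵉ θ (params Y)) ∘ χ⊢θ tt ∘ from (elementary Mᵉ χ (params X))
    }
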